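{- Let $\mathcal{G}$ denote the GHZ game and, for a positive integer $n$, let $\mathcal{G}^n$ denote its $n$-fold parallel repetition. Then $v(\mathcal{G}^n) \le n^{ -\Omega(1)}$; that is, there exist constants $c > 0$ and $C > 0$ such that $v(\mathcal{G}^n) \le C\, n^{ -c}$ for every positive integer $n$.
   Context: The GHZ game is a 3-player game. A question triple $x = (x_1,x_2,x_3)$ is drawn uniformly from $\mathcal{Q} = \{x \in \mathbb{F}_2^3 : x_1 + x_2 + x_3 = 0\}$; player $i$ receives $x_i$ and outputs an answer $y_i \in \mathbb{F}_2$; the players win iff $y_1 \oplus y_2 \oplus y_3 = x_1 \lor x_2 \lor x_3$. In the $n$-fold parallel repetition $\mathcal{G}^n$, question triples $x^{(1)},\dots,x^{(n)}$ are drawn independently from this distribution; player $i$ receives $(x^{(1)}_i,\dots,x^{(n)}_i) \in \mathbb{F}_2^n$ and outputs $(y^{(1)}_i,\dots,y^{(n)}_i) \in \mathbb{F}_2^n$ as a function of its input only (no communication); the players win iff they win the GHZ game in every coordinate $t \in [n]$. The value $v(\mathcal{G}^n)$ is the maximum, over all strategies (functions $f_i : \mathbb{F}_2^n \to \mathbb{F}_2^n$, $i=1,2,3$), of the winning probability. (The value of the GHZ game itself is $3/4$.) -}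

module Defs where

open import Data.Bool using (Bool; true; false; _∧_; _∨_; _xor_; not; if_then_else_)
open import Data.Nat using (ℕ; zero; suc; _+_)
open import Data.Product using (_×_; _,_)
open import Data.Vec using (Vec; []; _∷_; map; zipWith; foldr)
open import Data.List using (List; [_]; _++_; concatMap) renaming (map to mapL)
open import Data.Nat.ListAction using () renaming (sum to sumL)

Triple : Set
Triple = Bool × Bool × Bool

-- The question set 𝒬 = {x ∈ 𝔽₂³ : x₁ + x₂ + x₃ = 0}, listed without repetition.
ghzQuestions : List Triple
ghzQuestions =
  (false , false , false) Data.List.∷ (false , true , true) Data.List.∷
  (true , false , true) Data.List.∷ (true , true , false) Data.List.∷ Data.List.[]

-- All question tuples of the n-fold repetition, i.e. the elements of 𝒬ⁿ
-- (each listed exactly once; the uniform distribution on 𝒬ⁿ = product distribution).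
questionsⁿ : (n : ℕ) → List (Vec Triple n)
questionsⁿ zero = [ [] ]
questionsⁿ (suc n) = concatMap (λ q → mapL (q ∷_) (questionsⁿ n)) ghzQuestions

_==_ : Bool → Bool → Bool
a == b = not (a xor b)

ghzWin : Triple → Triple → Bool
ghzWin (x₁ , x₂ , x₃) (y₁ , y₂ , y₃) = (y₁ xor y₂ xor y₃) == (x₁ ∨ x₂ ∨ x₃)

Strategy : ℕ → Set
Strategy n = Vec Bool n → Vec Bool n

proj1 proj2 proj3 : Triple → Bool
proj1 (a , _ , _) = a
proj2 (_ , b , _) = b
proj3 (_ , _ , c) = c

winsⁿ : (n : ℕ) → Strategy n → Strategy n → Strategy n → Vec Triple n → Bool
winsⁿ n f₁ f₂ f₃ x =
  foldr _ _∧_ true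
    (zipWith ghzWin x
      (zipWith (λ a bc → a , bc)
        (f₁ (map proj1 x))
        (zipWith _,_ (f₂ (map proj2 x)) (f₃ (map proj3 x)))))

-- Number of question tuples in 𝒬ⁿ on which (f₁,f₂,f₃) wins.
-- The winning probability is  winCount n f₁ f₂ f₃ / 4ⁿ  (|𝒬ⁿ| = 4ⁿ).
winCount : (n : ℕ) → Strategy n → Strategy n → Strategy n → ℕ
winCount n f₁ f₂ f₃ =
  sumL (mapL (λ x → if winsⁿ n f₁ f₂ f₃ x then 1 else 0) (questionsⁿ n))

private
  open import Relation.Binary.PropositionalEquality using (_≡_; refl)
  test : winCount 1 (λ v → v) (λ v → v) (λ v → map not v) ≡ 3
  test = refl

{-# OPTIONS --safe #-}

-- Write W for the number of winning question tuples and N = 2ⁿ.  Call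
-- (v , y₁ , y₂ , z₁ , z₂) a pattern when, for all i and j, the vector
-- xᵢⱼ = yᵢ ⊕ zⱼ wins together with yᵢ and together with v (as questions of the
-- first two players).  For fixed v a pattern is a 4-cycle of a bipartite graph
-- on the y's and z's, so Cauchy–Schwarz bounds the number of patterns from
-- below by W⁸ / N¹¹.  Conversely a pattern is determined by y₂, z₁, x₁₂ and
-- p = x₁₁ ⊕ v.  Indeed q = x₂₂ ⊕ v = y₂ ⊕ x₁₂ ⊕ p ⊕ z₁, so the winning
-- conditions of (x₁₁ , y₁), (x₁₂ , y₁), (x₂₂ , y₂), (x₁₁ , v), (x₂₂ , v) add up
-- to an equation between answers to these known questions and a function of y₁
-- that is injective in each coordinate.  Hence there are at most N⁴ patterns
-- and W⁸ ≤ N¹⁵, that is, the value of the n-fold game is at most 2^(-n/8).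
module Submission where

open import Defs
open import Data.Nat using (ℕ; _*_; _^_; _≤_)
open import Data.Product using (Σ; _×_)

open import Data.Bool using (Bool; true; false; _∧_; _∨_; _xor_; not; if_then_else_)
open import Data.Bool.Properties using (∧-conicalˡ; ∧-conicalʳ; not-¬; xor-comm)
open import Data.Bool.Solver using (module xor-∧-Solver)
open import Data.Fin using (Fin; zero; suc)
open import Data.List using (List; []; _∷_; concatMap) renaming (map to mapL)
open import Data.List.Properties using (map-++; map-∘)
open import Data.Nat using (zero; suc; _+_; _<_; z≤n; s≤s)
open import Data.Nat.ListAction using () renaming (sum to sumL)
open import Data.Nat.ListAction.Properties using (sum-++)
open import Data.Nat.Properties
open import Data.Nat.Solver using (module +-*-Solver)
open import Data.Product using (_,_; proj₁; proj₂; ∃)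
open import Data.Sum using (_⊎_; inj₁; inj₂; [_,_]′)
open import Data.Vec using (Vec; []; _∷_; map; zipWith; foldr; lookup)
open import Data.Vec.Properties using (lookup-zipWith; zipWith-comm)
open import Data.Vec.Relation.Binary.Pointwise.Extensional using (ext; extensional⇒inductive)
open import Data.Vec.Relation.Binary.Pointwise.Inductive using (Pointwise-≡⇒≡)
open import Function using (_∘_)
open import Relation.Binary.PropositionalEquality
open import Relation.Nullary using (contradiction)

private
  variable
    n : ℕ

lookup-ext : {A : Set} {xs ys : Vec A n} → (∀ i → lookup xs i ≡ lookup ys i) → xs ≡ ys
lookup-ext eq = Pointwise-≡⇒≡ (extensional⇒inductive (ext eq))

-- Sums over 𝔽₂ⁿ

∑ : (Vec Bool n → ℕ) → ℕ
∑ {zero}  f = f []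
∑ {suc n} f = ∑ (f ∘ (false ∷_)) + ∑ (f ∘ (true ∷_))

∑-cong : {f g : Vec Bool n → ℕ} → (∀ x → f x ≡ g x) → ∑ f ≡ ∑ g
∑-cong {zero}  eq = eq []
∑-cong {suc n} eq = cong₂ _+_ (∑-cong (eq ∘ (false ∷_))) (∑-cong (eq ∘ (true ∷_)))

∑-mono : {f g : Vec Bool n → ℕ} → (∀ x → f x ≤ g x) → ∑ f ≤ ∑ g
∑-mono {zero}  le = le []
∑-mono {suc n} le = +-mono-≤ (∑-mono (le ∘ (false ∷_))) (∑-mono (le ∘ (true ∷_)))

∑-+ : (f g : Vec Bool n → ℕ) → ∑ (λ x → f x + g x) ≡ ∑ f + ∑ g
∑-+ {zero}  f g = refl
∑-+ {suc n} f g = begin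
  ∑ (λ x → f₀ x + g₀ x) + ∑ (λ x → f₁ x + g₁ x) ≡⟨ cong₂ _+_ (∑-+ f₀ g₀) (∑-+ f₁ g₁) ⟩
  (∑ f₀ + ∑ g₀) + (∑ f₁ + ∑ g₁)                 ≡⟨ interchange (∑ f₀) (∑ g₀) (∑ f₁) (∑ g₁) ⟩
  (∑ f₀ + ∑ f₁) + (∑ g₀ + ∑ g₁)                 ∎
  where
  open ≡-Reasoning
  f₀ = f ∘ (false ∷_)
  f₁ = f ∘ (true ∷_)
  g₀ = g ∘ (false ∷_)
  g₁ = g ∘ (true ∷_)
  interchange : ∀ a b c d → (a + b) + (c + d) ≡ (a + c) + (b + d)
  interchange = solve 4 (λ a b c d → (a :+ b) :+ (c :+ d) := (a :+ c) :+ (b :+ d)) refl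
    where open +-*-Solver

∑-*ˡ : ∀ c (f : Vec Bool n → ℕ) → ∑ (λ x → c * f x) ≡ c * ∑ f
∑-*ˡ {zero}  c f = refl
∑-*ˡ {suc n} c f = trans (cong₂ _+_ (∑-*ˡ {n} c _) (∑-*ˡ {n} c _)) (sym (*-distribˡ-+ c _ _))

∑-*ʳ : ∀ c (f : Vec Bool n → ℕ) → ∑ (λ x → f x * c) ≡ ∑ f * c
∑-*ʳ c f = trans (∑-cong (λ x → *-comm (f x) c)) (trans (∑-*ˡ c f) (*-comm c (∑ f)))

∑-const : ∀ c → ∑ {n} (λ _ → c) ≡ 2 ^ n * c
∑-const {zero}  c = sym (*-identityˡ c)
∑-const {suc n} c = begin
  ∑ {n} (λ _ → c) + ∑ {n} (λ _ → c) ≡⟨ cong₂ _+_ (∑-const {n} c) (∑-const {n} c) ⟩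
  2 ^ n * c + 2 ^ n * c             ≡⟨ solve 2 (λ N c → N :* c :+ N :* c := (con 2 :* N) :* c) refl (2 ^ n) c ⟩
  2 * 2 ^ n * c                     ∎
  where
  open ≡-Reasoning
  open +-*-Solver

∑-swap : ∀ {m n} (f : Vec Bool m → Vec Bool n → ℕ) →
         ∑ (λ x → ∑ (λ y → f x y)) ≡ ∑ (λ y → ∑ (λ x → f x y))
∑-swap {zero}  f = refl
∑-swap {suc m} {n} f = trans (cong₂ _+_ (∑-swap (f ∘ (false ∷_))) (∑-swap (f ∘ (true ∷_))))
                             (sym (∑-+ {n} _ _))

∑-rotate : ∀ {k l m} (f : Vec Bool k → Vec Bool l → Vec Bool m → ℕ) →
           ∑ (λ a → ∑ (λ b → ∑ (λ c → f a b c))) ≡ ∑ (λ c → ∑ (λ a → ∑ (λ b → f a b c)))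
∑-rotate {k} {l} {m} f = trans (∑-cong (λ a → ∑-swap (f a))) (∑-swap {k} {m} _)

infixr 6 _⊕_
_⊕_ : Vec Bool n → Vec Bool n → Vec Bool n
_⊕_ = zipWith _xor_

-- Adding `a` permutes the cube: a head `true` swaps its two halves, a head `false` fixes them.
∑-translate : ∀ (a : Vec Bool n) (f : Vec Bool n → ℕ) → ∑ (λ x → f (x ⊕ a)) ≡ ∑ f
∑-translate []          f = refl
∑-translate (false ∷ a) f = cong₂ _+_ (∑-translate a (f ∘ (false ∷_))) (∑-translate a (f ∘ (true ∷_)))
∑-translate (true ∷ a)  f = trans (cong₂ _+_ (∑-translate a (f ∘ (true ∷_))) (∑-translate a (f ∘ (false ∷_))))
                                  (+-comm (∑ (f ∘ (true ∷_))) _)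

∑-product : ∀ {m} (f : Vec Bool m → ℕ) (g : Vec Bool n → ℕ) →
            ∑ f * ∑ g ≡ ∑ (λ x → ∑ (λ y → f x * g y))
∑-product f g = trans (sym (∑-*ʳ (∑ g) f)) (∑-cong (λ x → sym (∑-*ˡ (f x) g)))

∑-positive : (f : Vec Bool n → ℕ) → ∑ f ≡ 0 ⊎ ∃ λ x → 0 < f x
∑-positive {zero} f with f [] in eq
... | zero  = inj₁ refl
... | suc k = inj₂ ([] , subst (0 <_) (sym eq) (s≤s z≤n))
∑-positive {suc n} f with ∑-positive (f ∘ (false ∷_)) | ∑-positive (f ∘ (true ∷_))
... | inj₂ (x , p) | _            = inj₂ (false ∷ x , p)
... | inj₁ _       | inj₂ (x , p) = inj₂ (true ∷ x , p)
... | inj₁ p       | inj₁ q       = inj₁ (cong₂ _+_ p q)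

-- Turns injectivity into a counting bound: a 0-1 weight supported on at most one point has total at
-- most 1. By uniqueness at least one half of the cube carries no weight, and induction treats the
-- other.
∑≤1 : (f : Vec Bool n → ℕ) → (∀ x → f x ≤ 1) → (∀ x y → 0 < f x → 0 < f y → x ≡ y) → ∑ f ≤ 1
∑≤1 {zero}  f le unique = le []
∑≤1 {suc n} f le unique with ∑-positive (f ∘ (false ∷_)) | ∑-positive (f ∘ (true ∷_))
... | inj₁ p | _ rewrite p =
  ∑≤1 _ (le ∘ (true ∷_)) (λ x y p q → cong Data.Vec.tail (unique _ _ p q))
... | _ | inj₁ q rewrite q | +-identityʳ (∑ (f ∘ (false ∷_))) =
  ∑≤1 _ (le ∘ (false ∷_)) (λ x y p q → cong Data.Vec.tail (unique _ _ p q))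
-- Support points in both halves would have to be equal, but their first bits differ.
... | inj₂ (x , p) | inj₂ (y , q) with () ← unique _ _ p q

-- Cauchy-Schwarz inequalities.

[m+n]²≤2[m²+n²] : ∀ a b → (a + b) ^ 2 ≤ 2 * (a ^ 2 + b ^ 2)
[m+n]²≤2[m²+n²] a b = [ ordered , flipped ∘ ordered ]′ (≤-total a b)
  where
  open +-*-Solver
  ordered : ∀ {a b} → a ≤ b → (a + b) ^ 2 ≤ 2 * (a ^ 2 + b ^ 2)
  -- The gap between the two sides is the square of the difference; assuming an order lets it be
  -- written as d² with b = a + d in ℕ.
  ordered {a} a≤b with d , refl ← m≤n⇒∃[o]m+o≡n a≤b = ≤-trans (m≤m+n _ (d ^ 2)) (≤-reflexive
    (solve 2 (λ a d → (a :+ (a :+ d)) :^ 2 :+ d :^ 2 := con 2 :* (a :^ 2 :+ (a :+ d) :^ 2)) refl a d))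
  flipped : (b + a) ^ 2 ≤ 2 * (b ^ 2 + a ^ 2) → (a + b) ^ 2 ≤ 2 * (a ^ 2 + b ^ 2)
  flipped = subst₂ _≤_ (cong (_^ 2) (+-comm b a)) (cong (2 *_) (+-comm (b ^ 2) (a ^ 2)))

∑-cauchy-schwarz : (f : Vec Bool n → ℕ) → ∑ f ^ 2 ≤ 2 ^ n * ∑ (λ x → f x ^ 2)
∑-cauchy-schwarz {zero}  f = ≤-reflexive (sym (*-identityˡ _))
∑-cauchy-schwarz {suc n} f = begin
  (∑ f₀ + ∑ f₁) ^ 2             ≤⟨ [m+n]²≤2[m²+n²] (∑ f₀) (∑ f₁) ⟩
  2 * (∑ f₀ ^ 2 + ∑ f₁ ^ 2)     ≤⟨ *-monoʳ-≤ 2 (+-mono-≤ (∑-cauchy-schwarz f₀) (∑-cauchy-schwarz f₁)) ⟩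
  2 * (2 ^ n * S₀ + 2 ^ n * S₁) ≡⟨ solve 3 (λ N a b → con 2 :* (N :* a :+ N :* b) := con 2 :* N :* (a :+ b)) refl (2 ^ n) S₀ S₁ ⟩
  2 ^ suc n * (S₀ + S₁)         ∎
  where
  open ≤-Reasoning
  open +-*-Solver
  f₀ = f ∘ (false ∷_)
  f₁ = f ∘ (true ∷_)
  S₀ = ∑ (λ x → f₀ x ^ 2)
  S₁ = ∑ (λ x → f₁ x ^ 2)

-- Cauchy-Schwarz for f, then for f².
∑-power-mean₄ : (f : Vec Bool n → ℕ) → ∑ f ^ 4 ≤ (2 ^ n) ^ 3 * ∑ (λ x → f x ^ 4)
∑-power-mean₄ {n} f = begin
  ∑ f ^ 4                                 ≡⟨ ^-*-assoc (∑ f) 2 2 ⟨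
  (∑ f ^ 2) ^ 2                           ≤⟨ ^-monoˡ-≤ 2 (∑-cauchy-schwarz f) ⟩
  (N * ∑ (λ x → f x ^ 2)) ^ 2             ≡⟨ solve 2 (λ N s → (N :* s) :^ 2 := N :^ 2 :* s :^ 2) refl N (∑ (λ x → f x ^ 2)) ⟩
  N ^ 2 * ∑ (λ x → f x ^ 2) ^ 2           ≤⟨ *-monoʳ-≤ (N ^ 2) (∑-cauchy-schwarz (λ x → f x ^ 2)) ⟩
  N ^ 2 * (N * ∑ (λ x → (f x ^ 2) ^ 2))   ≡⟨ solve 2 (λ N s → N :^ 2 :* (N :* s) := N :^ 3 :* s) refl N (∑ (λ x → (f x ^ 2) ^ 2)) ⟩
  N ^ 3 * ∑ (λ x → (f x ^ 2) ^ 2)         ≡⟨ cong (N ^ 3 *_) (∑-cong (λ x → ^-*-assoc (f x) 2 2)) ⟩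
  N ^ 3 * ∑ (λ x → f x ^ 4)               ∎
  where
  open ≤-Reasoning
  open +-*-Solver
  N = 2 ^ n

-- Weighted count of 4-cycles in a bipartite graph, degenerate ones included.
C₄ : (Vec Bool n → Vec Bool n → ℕ) → ℕ
C₄ m = ∑ λ z₁ → ∑ λ z₂ → ∑ λ y₁ → ∑ λ y₂ → (m y₁ z₁ * m y₁ z₂) * (m y₂ z₁ * m y₂ z₂)

-- Cauchy-Schwarz over y bounds e² by N times the sum of the codegrees of pairs (z₁ , z₂). After
-- squaring, Cauchy-Schwarz over z₁ and over z₂ leaves the squared codegrees, which count 4-cycles.
-- The factors are N² from the first round and N from each of the other two.
∑∑⁴≤C₄ : (m : Vec Bool n → Vec Bool n → ℕ) →
         ∑ (λ y → ∑ (λ z → m y z)) ^ 4 ≤ (2 ^ n) ^ 4 * C₄ m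
∑∑⁴≤C₄ {n} m = begin
  e ^ 4                                          ≡⟨ ^-*-assoc e 2 2 ⟨
  (e ^ 2) ^ 2                                    ≤⟨ ^-monoˡ-≤ 2 e²≤ ⟩
  (N * ∑ (λ z₁ → ∑ (λ z₂ → codeg z₁ z₂))) ^ 2   ≡⟨ solve 2 (λ N s → (N :* s) :^ 2 := N :^ 2 :* s :^ 2) refl N _ ⟩
  N ^ 2 * ∑ (λ z₁ → ∑ (λ z₂ → codeg z₁ z₂)) ^ 2 ≤⟨ *-monoʳ-≤ (N ^ 2) (∑-cauchy-schwarz (λ z₁ → ∑ (codeg z₁))) ⟩
  N ^ 2 * (N * ∑ (λ z₁ → ∑ (codeg z₁) ^ 2))
    ≤⟨ *-monoʳ-≤ (N ^ 2) (*-monoʳ-≤ N (∑-mono (λ z₁ → ∑-cauchy-schwarz (codeg z₁)))) ⟩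
  N ^ 2 * (N * ∑ (λ z₁ → N * ∑ (λ z₂ → codeg z₁ z₂ ^ 2)))
    ≡⟨ cong (λ s → N ^ 2 * (N * s)) (∑-*ˡ {n} N _) ⟩
  N ^ 2 * (N * (N * ∑ (λ z₁ → ∑ (λ z₂ → codeg z₁ z₂ ^ 2))))
    ≡⟨ solve 2 (λ N s → N :^ 2 :* (N :* (N :* s)) := N :^ 4 :* s) refl N _ ⟩
  N ^ 4 * ∑ (λ z₁ → ∑ (λ z₂ → codeg z₁ z₂ ^ 2))
    ≡⟨ cong (N ^ 4 *_) (∑-cong λ z₁ → ∑-cong λ z₂ → square (λ y → m y z₁ * m y z₂)) ⟩
  N ^ 4 * C₄ m ∎
  where
  open ≤-Reasoning
  open +-*-Solver
  N = 2 ^ n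
  e = ∑ (λ y → ∑ (λ z → m y z))
  codeg : Vec Bool n → Vec Bool n → ℕ
  codeg z₁ z₂ = ∑ (λ y → m y z₁ * m y z₂)
  square : (f : Vec Bool n → ℕ) → ∑ f ^ 2 ≡ ∑ (λ x → ∑ (λ y → f x * f y))
  square f = trans (cong (∑ f *_) (*-identityʳ (∑ f))) (∑-product f f)
  e²≤ : e ^ 2 ≤ N * ∑ (λ z₁ → ∑ (λ z₂ → codeg z₁ z₂))
  e²≤ = begin
    e ^ 2                                                          ≤⟨ ∑-cauchy-schwarz (λ y → ∑ (m y)) ⟩
    -- The squared degree of y counts pairs of neighbours z₁, z₂; moving the sum over y inside
    -- groups them into codegrees.
    N * ∑ (λ y → ∑ (m y) ^ 2)                                      ≡⟨ cong (N *_) (∑-cong λ y → square (m y)) ⟩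
    N * ∑ (λ y → ∑ (λ z₁ → ∑ (λ z₂ → m y z₁ * m y z₂)))            ≡⟨ cong (N *_) (sym (∑-rotate (λ z₁ z₂ y → m y z₁ * m y z₂))) ⟩
    N * ∑ (λ z₁ → ∑ (λ z₂ → codeg z₁ z₂))                          ∎

-- Winning questions

question : Vec Bool n → Vec Bool n → Vec Triple n
question = zipWith (λ a b → a , b , a xor b)

-- The first two questions are free and determine the third. `ghzQuestions` lists them in the order
-- 00, 01, 10, 11, which is the order of the double sum, so only the bracketing changes.
∑-questions : (φ : Vec Triple n → ℕ) →
              sumL (mapL φ (questionsⁿ n)) ≡ ∑ (λ x → ∑ (λ y → φ (question x y)))
∑-questions {zero}  φ = +-identityʳ _
∑-questions {suc n} φ = begin
  sumL (mapL φ (concatMap (λ q → mapL (q ∷_) (questionsⁿ n)) ghzQuestions))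
    ≡⟨ sum-concatMap ghzQuestions ⟩
  S (false , false , false) + (S (false , true , true) + (S (true , false , true) + (S (true , true , false) + 0)))
    ≡⟨ solve 4 (λ a b c d → a :+ (b :+ (c :+ (d :+ con 0))) := (a :+ b) :+ (c :+ d)) refl (S (false , false , false)) (S (false , true , true)) (S (true , false , true)) (S (true , true , false)) ⟩
  (S (false , false , false) + S (false , true , true)) + (S (true , false , true) + S (true , true , false))
    ≡⟨ cong₂ _+_ (sym (∑-+ {n} _ _)) (sym (∑-+ {n} _ _)) ⟩
  ∑ (λ x → ∑ (λ y → φ (question x y))) ∎
  where
  open ≡-Reasoning
  open +-*-Solver
  S : Triple → ℕ
  S q = ∑ (λ x → ∑ (λ y → φ (q ∷ question x y)))
  sum-concatMap : (qs : List Triple) →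
    sumL (mapL φ (concatMap (λ q → mapL (q ∷_) (questionsⁿ n)) qs)) ≡ sumL (mapL S qs)
  sum-concatMap []       = refl
  sum-concatMap (q ∷ qs) = begin
    sumL (mapL φ (mapL (q ∷_) (questionsⁿ n) Data.List.++ rest))
      ≡⟨ cong sumL (map-++ φ (mapL (q ∷_) (questionsⁿ n)) rest) ⟩
    sumL (mapL φ (mapL (q ∷_) (questionsⁿ n)) Data.List.++ mapL φ rest)
      ≡⟨ sum-++ (mapL φ (mapL (q ∷_) (questionsⁿ n))) (mapL φ rest) ⟩
    sumL (mapL φ (mapL (q ∷_) (questionsⁿ n))) + sumL (mapL φ rest)
      ≡⟨ cong₂ _+_ (trans (cong sumL (sym (map-∘ (questionsⁿ n)))) (∑-questions (φ ∘ (q ∷_)))) (sum-concatMap qs) ⟩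
    S q + sumL (mapL S qs) ∎
    where rest = concatMap (λ q → mapL (q ∷_) (questionsⁿ n)) qs

map-proj1-question : (x y : Vec Bool n) → map proj1 (question x y) ≡ x
map-proj1-question []      []      = refl
map-proj1-question (a ∷ x) (b ∷ y) = cong (a ∷_) (map-proj1-question x y)

map-proj2-question : (x y : Vec Bool n) → map proj2 (question x y) ≡ y
map-proj2-question []      []      = refl
map-proj2-question (a ∷ x) (b ∷ y) = cong (b ∷_) (map-proj2-question x y)

map-proj3-question : (x y : Vec Bool n) → map proj3 (question x y) ≡ x ⊕ y
map-proj3-question []      []      = refl
map-proj3-question (a ∷ x) (b ∷ y) = cong ((a xor b) ∷_) (map-proj3-question x y)

-- Winning conditions coordinate by coordinate.

==⇒≡ : ∀ a b → (a == b) ≡ true → a ≡ b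
==⇒≡ true  true  _ = refl
==⇒≡ false false _ = refl

-- The parity demanded by the GHZ game, with the third question bit written as the sum of the other
-- two.
or₃ : Bool → Bool → Bool
or₃ a b = a ∨ b ∨ (a xor b)

-- The answers are arbitrary vectors here, since a strategy cannot be restricted to the tail of its
-- input in the induction.
wins-lookup : (x y a b c : Vec Bool n) →
  foldr _ _∧_ true (zipWith ghzWin (question x y) (zipWith (λ a bc → a , bc) a (zipWith _,_ b c))) ≡ true →
  ∀ i → lookup a i xor (lookup b i xor lookup c i) ≡ or₃ (lookup x i) (lookup y i)
wins-lookup (_ ∷ _) (_ ∷ _) (_ ∷ _) (_ ∷ _) (_ ∷ _) w zero    = ==⇒≡ _ _ (∧-conicalˡ _ _ w)
wins-lookup (_ ∷ x) (_ ∷ y) (_ ∷ a) (_ ∷ b) (_ ∷ c) w (suc i) = wins-lookup x y a b c (∧-conicalʳ _ _ w) i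

-- The sum of the right-hand sides of the winning conditions of (x₁₁ , y₁),
-- (x₁₂ , y₁), (x₂₂ , y₂), (x₁₁ , v), (x₂₂ , v) in one coordinate.
rhs : (y₂ z₁ p x₁₂ y₁ : Bool) → Bool
rhs y₂ z₁ p x₁₂ y₁ =
  or₃ x₁₁ y₁ xor (or₃ x₁₂ y₁ xor (or₃ x₂₂ y₂ xor (or₃ x₁₁ v xor or₃ x₂₂ v)))
  where
  x₁₁ = y₁ xor z₁
  v   = p xor x₁₁
  x₂₂ = y₂ xor (x₁₂ xor y₁)

-- Over 𝔽₂, `or₃ a b` equals a + b + ab. The linear terms add up to x₁₂ + y₂. The quadratic terms
-- are affine in y₁, because y₁² = y₁ and x₁₁ + x₂₂ = z₁ + y₂ + x₁₂ is free of y₁; the coefficient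
-- of y₁ is (1 + z₁) + x₁₂ + y₂ + (z₁ + y₂ + x₁₂) = 1.
rhs-flip : ∀ y₂ z₁ p x → rhs y₂ z₁ p x true ≡ not (rhs y₂ z₁ p x false)
rhs-flip false false false false = refl
rhs-flip false false false true  = refl
rhs-flip false false true  false = refl
rhs-flip false false true  true  = refl
rhs-flip false true  false false = refl
rhs-flip false true  false true  = refl
rhs-flip false true  true  false = refl
rhs-flip false true  true  true  = refl
rhs-flip true  false false false = refl
rhs-flip true  false false true  = refl
rhs-flip true  false true  false = refl
rhs-flip true  false true  true  = refl
rhs-flip true  true  false false = refl
rhs-flip true  true  false true  = refl
rhs-flip true  true  true  false = refl
rhs-flip true  true  true  true  = refl

rhs-injective : ∀ y₂ z₁ p x {y y′} → rhs y₂ z₁ p x y ≡ rhs y₂ z₁ p x y′ → y ≡ y′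
rhs-injective _  _  _ _ {false} {false} _  = refl
rhs-injective _  _  _ _ {true}  {true}  _  = refl
rhs-injective y₂ z₁ p x {false} {true}  eq = contradiction (trans eq (rhs-flip y₂ z₁ p x)) (not-¬ refl)
rhs-injective y₂ z₁ p x {true}  {false} eq = contradiction (trans (sym eq) (rhs-flip y₂ z₁ p x)) (not-¬ refl)

rhs-lookup : ∀ (y₂ z₁ p x y₁ : Vec Bool n) i →
  let x₁₁ = y₁ ⊕ z₁
      v   = p ⊕ x₁₁
      x₂₂ = y₂ ⊕ (x ⊕ y₁)
  in rhs (lookup y₂ i) (lookup z₁ i) (lookup p i) (lookup x i) (lookup y₁ i) ≡
     or₃ (lookup x₁₁ i) (lookup y₁ i) xor (or₃ (lookup x i) (lookup y₁ i) xor (or₃ (lookup x₂₂ i) (lookup y₂ i) xor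
       (or₃ (lookup x₁₁ i) (lookup v i) xor or₃ (lookup x₂₂ i) (lookup v i))))
rhs-lookup y₂ z₁ p x y₁ i
  rewrite lookup-zipWith _xor_ i p (y₁ ⊕ z₁) | lookup-zipWith _xor_ i y₁ z₁
        | lookup-zipWith _xor_ i y₂ (x ⊕ y₁) | lookup-zipWith _xor_ i x y₁ = refl

-- Identities for addition in 𝔽₂ⁿ.

⊕-cancelʳ : (x y : Vec Bool n) → (x ⊕ y) ⊕ y ≡ x
⊕-cancelʳ []      []      = refl
⊕-cancelʳ (a ∷ x) (b ∷ y) = cong₂ _∷_ (solve 2 (λ a b → (a :+ b) :+ b := a) refl a b) (⊕-cancelʳ x y)
  where open xor-∧-Solver

⊕-comm : (x y : Vec Bool n) → x ⊕ y ≡ y ⊕ x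
⊕-comm = zipWith-comm xor-comm

⊕-conjugate : (x y : Vec Bool n) → (x ⊕ y) ⊕ x ≡ y
⊕-conjugate x y = trans (cong (_⊕ x) (⊕-comm x y)) (⊕-cancelʳ y x)

-- Serves to compute x₂₂ ⊕ v: both summands contain y₁, which cancels, so the third question q
-- depends on the four parameters alone.
⊕-cancel-middle : (a b y c d : Vec Bool n) → (a ⊕ (b ⊕ y)) ⊕ (c ⊕ (y ⊕ d)) ≡ (a ⊕ b) ⊕ (c ⊕ d)
⊕-cancel-middle []      []      []      []      []      = refl
⊕-cancel-middle (a ∷ u) (b ∷ v) (y ∷ w) (c ∷ x) (d ∷ z) = cong₂ _∷_
  (solve 5 (λ a b y c d → (a :+ (b :+ y)) :+ (c :+ (y :+ d)) := (a :+ b) :+ (c :+ d)) refl a b y c d)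
  (⊕-cancel-middle u v w x z)
  where open xor-∧-Solver

m*n>0 : ∀ m n → 0 < m * n → 0 < m × 0 < n
m*n>0 (suc m) (suc n) _    = s≤s z≤n , s≤s z≤n
m*n>0 (suc m) zero    m0>0 = contradiction (subst (0 <_) (*-zeroʳ m) m0>0) λ ()

-- Patterns of a fixed triple of strategies.

module _ {n : ℕ} (f₁ f₂ f₃ : Strategy n) where

  private
    N = 2 ^ n

  Wins : Vec Bool n → Vec Bool n → Set
  Wins x y = winsⁿ n f₁ f₂ f₃ (question x y) ≡ true

  -- The third question is a separate `z`, so that each use can put in a form of it from which
  -- unknown vectors have been cancelled.
  wins-equation : ∀ {x y z} → Wins x y → x ⊕ y ≡ z → ∀ i →
    lookup (f₁ x) i xor (lookup (f₂ y) i xor lookup (f₃ z) i) ≡ or₃ (lookup x i) (lookup y i)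
  wins-equation {x} {y} w refl i with eq ← wins-lookup x y _ _ _ w i
    rewrite map-proj1-question x y | map-proj2-question x y | map-proj3-question x y = eq

  edge : Vec Bool n → Vec Bool n → ℕ
  edge x y = if winsⁿ n f₁ f₂ f₃ (question x y) then 1 else 0

  edge≤1 : ∀ x y → edge x y ≤ 1
  edge≤1 x y with winsⁿ n f₁ f₂ f₃ (question x y)
  ... | true  = s≤s z≤n
  ... | false = z≤n

  edge>0⇒Wins : ∀ x y → 0 < edge x y → Wins x y
  edge>0⇒Wins x y e with true ← winsⁿ n f₁ f₂ f₃ (question x y) = refl

  -- If the first two questions are y ⊕ z and y, then z is the third. Hence an edge at z involves
  -- the third player's answer to z, whatever y is.
  link : (v y z : Vec Bool n) → ℕ
  link v y z = edge (y ⊕ z) y * edge (y ⊕ z) v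

  isPattern : (v z₁ z₂ y₁ y₂ : Vec Bool n) → ℕ
  isPattern v z₁ z₂ y₁ y₂ = (link v y₁ z₁ * link v y₁ z₂) * (link v y₂ z₁ * link v y₂ z₂)

  -- Lower bound on the number of patterns.

  winCount⁸≤N¹¹∑C₄ : winCount n f₁ f₂ f₃ ^ 8 ≤ N ^ 11 * ∑ (λ v → C₄ (link v))
  winCount⁸≤N¹¹∑C₄ = begin
    W ^ 8                                         ≡⟨ ^-*-assoc W 2 4 ⟨
    (W ^ 2) ^ 4                                   ≤⟨ ^-monoˡ-≤ 4 W²≤ ⟩
    (N * ∑ e) ^ 4                                 ≡⟨ solve 2 (λ N s → (N :* s) :^ 4 := N :^ 4 :* s :^ 4) refl N (∑ e) ⟩
    N ^ 4 * ∑ e ^ 4                               ≤⟨ *-monoʳ-≤ (N ^ 4) (∑-power-mean₄ e) ⟩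
    N ^ 4 * (N ^ 3 * ∑ (λ v → e v ^ 4))
      ≤⟨ *-monoʳ-≤ (N ^ 4) (*-monoʳ-≤ (N ^ 3) (∑-mono (λ v → ∑∑⁴≤C₄ (link v)))) ⟩
    N ^ 4 * (N ^ 3 * ∑ (λ v → N ^ 4 * C₄ (link v)))
      ≡⟨ cong (λ s → N ^ 4 * (N ^ 3 * s)) (∑-*ˡ (N ^ 4) (λ v → C₄ (link v))) ⟩
    -- N⁴ stems from Cauchy-Schwarz over x, raised to the fourth power; N³ from the power mean over
    -- v; N⁴ from the 4-cycle bound.
    N ^ 4 * (N ^ 3 * (N ^ 4 * T))
      ≡⟨ solve 2 (λ N s → N :^ 4 :* (N :^ 3 :* (N :^ 4 :* s)) := N :^ 11 :* s) refl N T ⟩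
    N ^ 11 * T ∎
    where
    open ≤-Reasoning
    open +-*-Solver
    W = winCount n f₁ f₂ f₃
    T = ∑ (λ v → C₄ (link v))
    deg : Vec Bool n → ℕ
    deg x = ∑ (edge x)
    e : Vec Bool n → ℕ
    e v = ∑ (λ y → ∑ (λ z → link v y z))
    -- The squared degree of x counts pairs (y , v) that both win with x. For fixed y and v,
    -- substituting x = y ⊕ z turns these into edges of the graph `link v`.
    ∑deg²≡∑e : ∑ (λ x → deg x ^ 2) ≡ ∑ e
    ∑deg²≡∑e = begin-equality
      ∑ (λ x → deg x ^ 2)
        ≡⟨ ∑-cong (λ x → trans (cong (deg x *_) (*-identityʳ (deg x))) (∑-product (edge x) (edge x))) ⟩
      ∑ (λ x → ∑ (λ y → ∑ (λ v → edge x y * edge x v)))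
        ≡⟨ ∑-rotate (λ x y v → edge x y * edge x v) ⟩
      ∑ (λ v → ∑ (λ x → ∑ (λ y → edge x y * edge x v)))
        ≡⟨ ∑-cong (λ v → ∑-swap (λ x y → edge x y * edge x v)) ⟩
      ∑ (λ v → ∑ (λ y → ∑ (λ x → edge x y * edge x v)))
        ≡⟨ ∑-cong (λ v → ∑-cong (λ y → sym (∑-translate y (λ x → edge x y * edge x v)))) ⟩
      ∑ (λ v → ∑ (λ y → ∑ (λ z → edge (z ⊕ y) y * edge (z ⊕ y) v)))
        ≡⟨ ∑-cong (λ v → ∑-cong (λ y → ∑-cong (λ z → cong (λ x → edge x y * edge x v) (⊕-comm z y)))) ⟩
      ∑ e ∎
    W²≤ : W ^ 2 ≤ N * ∑ e
    W²≤ = begin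
      W ^ 2                        ≡⟨ cong (_^ 2) (∑-questions (λ x → if winsⁿ n f₁ f₂ f₃ x then 1 else 0)) ⟩
      ∑ deg ^ 2                    ≤⟨ ∑-cauchy-schwarz deg ⟩
      N * ∑ (λ x → deg x ^ 2)      ≡⟨ cong (N *_) ∑deg²≡∑e ⟩
      N * ∑ e                      ∎

  -- Upper bound on the number of patterns.

  isPattern≤1 : ∀ v z₁ z₂ y₁ y₂ → isPattern v z₁ z₂ y₁ y₂ ≤ 1
  isPattern≤1 v z₁ z₂ y₁ y₂ = *-mono-≤ (*-mono-≤ (link≤1 y₁ z₁) (link≤1 y₁ z₂)) (*-mono-≤ (link≤1 y₂ z₁) (link≤1 y₂ z₂))
    where
    link≤1 : ∀ y z → link v y z ≤ 1
    link≤1 y z = *-mono-≤ (edge≤1 (y ⊕ z) y) (edge≤1 (y ⊕ z) v)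

  link>0⇒Wins : ∀ v y z → 0 < link v y z → Wins (y ⊕ z) y × Wins (y ⊕ z) v
  link>0⇒Wins v y z l>0 with e , e′ ← m*n>0 (edge (y ⊕ z) y) _ l>0 =
    edge>0⇒Wins (y ⊕ z) y e , edge>0⇒Wins (y ⊕ z) v e′

  isPattern⇒Wins : ∀ v z₁ z₂ y₁ y₂ → 0 < isPattern v z₁ z₂ y₁ y₂ →
    (Wins (y₁ ⊕ z₁) y₁ × Wins (y₁ ⊕ z₁) v) × Wins (y₁ ⊕ z₂) y₁ ×
    (Wins (y₂ ⊕ z₂) y₂ × Wins (y₂ ⊕ z₂) v)
  isPattern⇒Wins v z₁ z₂ y₁ y₂ p>0
    with l , l′ ← m*n>0 (link v y₁ z₁ * link v y₁ z₂) _ p>0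
    with l₁₁ , l₁₂ ← m*n>0 (link v y₁ z₁) _ l | _ , l₂₂ ← m*n>0 (link v y₂ z₁) _ l′ =
    link>0⇒Wins v y₁ z₁ l₁₁ , proj₁ (link>0⇒Wins v y₁ z₂ l₁₂) , link>0⇒Wins v y₂ z₂ l₂₂

  -- Here x is x₁₂, so that z₂ = x ⊕ y₁ and v = p ⊕ x₁₁.
  reindexed : (y₂ z₁ p x y₁ : Vec Bool n) → ℕ
  reindexed y₂ z₁ p x y₁ = isPattern (p ⊕ (y₁ ⊕ z₁)) z₁ (x ⊕ y₁) y₁ y₂

  -- Every question here is determined by y₂, z₁, p and x; the last one is q = x₂₂ ⊕ v with y₁
  -- cancelled.
  answers : (y₂ z₁ p x : Vec Bool n) → Fin n → Bool
  answers y₂ z₁ p x i =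
    lookup (f₁ x) i xor (lookup (f₂ y₂) i xor (lookup (f₃ z₁) i xor
      (lookup (f₃ p) i xor lookup (f₃ ((y₂ ⊕ x) ⊕ (p ⊕ z₁))) i)))

  rhs≡answers : ∀ y₂ z₁ p x y₁ → 0 < reindexed y₂ z₁ p x y₁ → ∀ i →
    rhs (lookup y₂ i) (lookup z₁ i) (lookup p i) (lookup x i) (lookup y₁ i) ≡ answers y₂ z₁ p x i
  rhs≡answers y₂ z₁ p x y₁ r>0 i = begin
    rhs (lookup y₂ i) (lookup z₁ i) (lookup p i) (lookup x i) (lookup y₁ i)
      ≡⟨ rhs-lookup y₂ z₁ p x y₁ i ⟩
    or₃ (lookup x₁₁ i) (lookup y₁ i) xor (or₃ (lookup x i) (lookup y₁ i) xor (or₃ (lookup x₂₂ i) (lookup y₂ i) xor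
      (or₃ (lookup x₁₁ i) (lookup v i) xor or₃ (lookup x₂₂ i) (lookup v i))))
      ≡⟨ cong₂ _xor_ (eq w₁₁ (⊕-conjugate y₁ z₁)) (cong₂ _xor_ (eq w₁₂ refl)
           (cong₂ _xor_ (eq w₂₂ (⊕-conjugate y₂ z₂)) (cong₂ _xor_ (eq u₁₁ p≡) (eq u₂₂ (⊕-cancel-middle y₂ x y₁ p z₁))))) ⟨
    (F x₁₁ xor (G y₁ xor H z₁)) xor ((F x xor (G y₁ xor H z₂)) xor ((F x₂₂ xor (G y₂ xor H z₂)) xor
      ((F x₁₁ xor (G v xor H p)) xor (F x₂₂ xor (G v xor H q)))))
      -- The answers to x₁₁, y₁, z₂, x₂₂ and v each occur in two of the five equations and cancel.
      ≡⟨ solve 10 (λ a b c d e f g h i j →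
           (a :+ (b :+ c)) :+ ((d :+ (b :+ e)) :+ ((f :+ (g :+ e)) :+ ((a :+ (h :+ i)) :+ (f :+ (h :+ j)))))
             := d :+ (g :+ (c :+ (i :+ j))))
           refl (F x₁₁) (G y₁) (H z₁) (F x) (H z₂) (F x₂₂) (G y₂) (G v) (H p) (H q) ⟩
    answers y₂ z₁ p x i ∎
    where
    open ≡-Reasoning
    open xor-∧-Solver
    x₁₁ = y₁ ⊕ z₁
    v   = p ⊕ x₁₁
    z₂  = x ⊕ y₁
    x₂₂ = y₂ ⊕ z₂
    q   = (y₂ ⊕ x) ⊕ (p ⊕ z₁)
    F G H : Vec Bool n → Bool
    F a = lookup (f₁ a) i
    G a = lookup (f₂ a) i
    H a = lookup (f₃ a) i
    eq : ∀ {a b c} → Wins a b → a ⊕ b ≡ c → F a xor (G b xor H c) ≡ or₃ (lookup a i) (lookup b i)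
    eq w a⊕b≡c = wins-equation w a⊕b≡c i
    wins = isPattern⇒Wins v z₁ z₂ y₁ y₂ r>0
    w₁₁ = proj₁ (proj₁ wins)
    u₁₁ = proj₂ (proj₁ wins)
    w₂₂ = proj₁ (proj₂ (proj₂ wins))
    u₂₂ = proj₂ (proj₂ (proj₂ wins))
    w₁₂ : Wins x y₁
    w₁₂ = subst (λ a → Wins a y₁) (trans (⊕-comm y₁ z₂) (⊕-cancelʳ x y₁)) (proj₁ (proj₂ wins))
    p≡ : x₁₁ ⊕ v ≡ p
    p≡ = trans (⊕-comm x₁₁ v) (⊕-cancelʳ p x₁₁)

  -- Patterns with the same four parameters have the same `answers`, hence equal `rhs` in every
  -- coordinate, and `rhs-injective` recovers each bit of y₁.
  ∑reindexed≤1 : ∀ y₂ z₁ p x → ∑ (reindexed y₂ z₁ p x) ≤ 1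
  ∑reindexed≤1 y₂ z₁ p x = ∑≤1 (reindexed y₂ z₁ p x) (λ y₁ → isPattern≤1 _ z₁ _ y₁ y₂) λ y y′ r>0 r′>0 →
    lookup-ext λ i → rhs-injective (lookup y₂ i) (lookup z₁ i) (lookup p i) (lookup x i)
      (trans (rhs≡answers y₂ z₁ p x y r>0 i) (sym (rhs≡answers y₂ z₁ p x y′ r′>0 i)))

  -- After reindexing, each of z₁, y₂, p and x contributes a factor N, and the innermost sum over y₁
  -- is at most 1.
  ∑C₄≤N⁴ : ∑ (λ v → C₄ (link v)) ≤ N ^ 4
  ∑C₄≤N⁴ = begin
    ∑ (λ v → ∑ λ z₁ → ∑ λ z₂ → ∑ λ y₁ → ∑ λ y₂ → isPattern v z₁ z₂ y₁ y₂)
      ≡⟨ ∑-swap (λ v z₁ → ∑ λ z₂ → ∑ λ y₁ → ∑ λ y₂ → isPattern v z₁ z₂ y₁ y₂) ⟩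
    ∑ (λ z₁ → ∑ λ v → ∑ λ z₂ → ∑ λ y₁ → ∑ λ y₂ → isPattern v z₁ z₂ y₁ y₂)
      ≤⟨ ∑-mono (λ z₁ → begin
        ∑ (λ v → ∑ λ z₂ → ∑ λ y₁ → ∑ λ y₂ → isPattern v z₁ z₂ y₁ y₂)
          ≡⟨ ∑-cong (λ v → ∑-rotate (λ z₂ y₁ y₂ → isPattern v z₁ z₂ y₁ y₂)) ⟩
        ∑ (λ v → ∑ λ y₂ → ∑ λ z₂ → ∑ λ y₁ → isPattern v z₁ z₂ y₁ y₂)
          ≡⟨ ∑-swap (λ v y₂ → ∑ λ z₂ → ∑ λ y₁ → isPattern v z₁ z₂ y₁ y₂) ⟩
        ∑ (λ y₂ → ∑ λ v → ∑ λ z₂ → ∑ λ y₁ → isPattern v z₁ z₂ y₁ y₂)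
          ≤⟨ ∑-mono (λ y₂ → fibre y₂ z₁) ⟩
        ∑ {n} (λ y₂ → N * (N * 1)) ∎) ⟩
    ∑ {n} (λ z₁ → ∑ {n} (λ y₂ → N * (N * 1)))
      ≡⟨ ∑-cong {n} (λ z₁ → ∑-const {n} (N * (N * 1))) ⟩
    ∑ {n} (λ z₁ → N * (N * (N * 1)))
      ≡⟨ ∑-const {n} (N * (N * (N * 1))) ⟩
    N ^ 4 ∎
    where
    open ≤-Reasoning
    fibre : ∀ y₂ z₁ → ∑ (λ v → ∑ λ z₂ → ∑ λ y₁ → isPattern v z₁ z₂ y₁ y₂) ≤ N * (N * 1)
    fibre y₂ z₁ = begin
      ∑ (λ v → ∑ λ z₂ → ∑ λ y₁ → isPattern v z₁ z₂ y₁ y₂)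
        -- The substitutions z₂ = x ⊕ y₁ and v = p ⊕ (y₁ ⊕ z₁) are translations only for fixed y₁,
        -- so y₁ goes outermost and returns inside afterwards.
        ≡⟨ ∑-rotate (λ v z₂ y₁ → isPattern v z₁ z₂ y₁ y₂) ⟩
      ∑ (λ y₁ → ∑ λ v → ∑ λ z₂ → isPattern v z₁ z₂ y₁ y₂)
        ≡⟨ ∑-cong (λ y₁ → ∑-cong (λ v → ∑-translate y₁ (λ z₂ → isPattern v z₁ z₂ y₁ y₂))) ⟨
      ∑ (λ y₁ → ∑ λ v → ∑ λ x → isPattern v z₁ (x ⊕ y₁) y₁ y₂)
        ≡⟨ ∑-cong (λ y₁ → ∑-translate (y₁ ⊕ z₁) (λ v → ∑ λ x → isPattern v z₁ (x ⊕ y₁) y₁ y₂)) ⟨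
      ∑ (λ y₁ → ∑ λ p → ∑ λ x → reindexed y₂ z₁ p x y₁)
        ≡⟨ ∑-rotate (λ p x y₁ → reindexed y₂ z₁ p x y₁) ⟨
      ∑ (λ p → ∑ λ x → ∑ λ y₁ → reindexed y₂ z₁ p x y₁)
        ≤⟨ ∑-mono (λ p → ∑-mono (λ x → ∑reindexed≤1 y₂ z₁ p x)) ⟩
      ∑ {n} (λ p → ∑ {n} (λ x → 1))
        ≡⟨ ∑-cong {n} (λ p → ∑-const {n} 1) ⟩
      ∑ {n} (λ p → N * 1)
        ≡⟨ ∑-const {n} (N * 1) ⟩
      N * (N * 1) ∎

  winCount⁸≤N¹⁵ : winCount n f₁ f₂ f₃ ^ 8 ≤ N ^ 15
  winCount⁸≤N¹⁵ = begin
    winCount n f₁ f₂ f₃ ^ 8          ≤⟨ winCount⁸≤N¹¹∑C₄ ⟩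
    N ^ 11 * ∑ (λ v → C₄ (link v))   ≤⟨ *-monoʳ-≤ (N ^ 11) ∑C₄≤N⁴ ⟩
    N ^ 11 * N ^ 4                   ≡⟨ ^-distribˡ-+-* N 11 4 ⟨
    N ^ 15                           ∎
    where open ≤-Reasoning

-- From exponential to polynomial decay.

n≤2^n : ∀ n → n ≤ 2 ^ n
n≤2^n zero    = z≤n
n≤2^n (suc n) = +-mono-≤ {1} {2 ^ n} (m^n>0 2 n) (≤-trans (n≤2^n n) (m≤m+n (2 ^ n) 0))

theorem8p1 : Σ ℕ λ p → Σ ℕ λ q → Σ ℕ λ K →
    (1 ≤ p) × (1 ≤ q) ×
    ((n : ℕ) → 1 ≤ n → (f₁ f₂ f₃ : Strategy n) →
    winCount n f₁ f₂ f₃ ^ q * n ^ p ≤ K * 4 ^ (n * q))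
-- The bound W⁸ ≤ N¹⁵ lies a factor N below N¹⁶ = 4^(8n), and n ≤ N fits into that factor. This
-- gives the exponent c = 1/8 with constant 1.
theorem8p1 = 1 , 8 , 1 , s≤s z≤n , s≤s z≤n , λ n _ f₁ f₂ f₃ → begin
  winCount n f₁ f₂ f₃ ^ 8 * n ^ 1  ≤⟨ *-mono-≤ (winCount⁸≤N¹⁵ f₁ f₂ f₃) (^-monoˡ-≤ 1 (n≤2^n n)) ⟩
  (2 ^ n) ^ 15 * (2 ^ n) ^ 1       ≡⟨ ^-distribˡ-+-* (2 ^ n) 15 1 ⟨
  (2 ^ n) ^ 16                     ≡⟨ ^-*-assoc (2 ^ n) 2 8 ⟨
  ((2 ^ n) ^ 2) ^ 8                ≡⟨ cong (_^ 8) (trans (^-*-assoc 2 n 2) (cong (2 ^_) (*-comm n 2))) ⟩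
  (2 ^ (2 * n)) ^ 8                ≡⟨ cong (_^ 8) (sym (^-*-assoc 2 2 n)) ⟩
  (4 ^ n) ^ 8                      ≡⟨ ^-*-assoc 4 n 8 ⟩
  4 ^ (n * 8)                      ≡⟨ *-identityˡ _ ⟨
  1 * 4 ^ (n * 8)                  ∎
  where open ≤-Reasoning
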